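{- By repeated removal of pairs of parallel edges, each reduced partition of $\{1,\ldots,n\}$ ($n\ge1$) may be transformed into a primitive partition. This primitive partition does not depend on the order in which the removals are performed.
   Context: For $n\ge1$ let $\zeta_n=(1,2,\ldots,n)$; additions $i+1$ are modulo $n$, i.e. $i+1$ means $\zeta_n(i)$. Products of permutations are composed right to left. A permutation $\alpha$ of $\{1,\ldots,n\}$ is a partition if each of its cycles, listed beginning with its least element, is an increasing list. An element $i$ is a dual fixed point of $\alpha$ if $\alpha(i)=i+1$ (equivalently, $i$ is a fixed point of $\alpha^{ -1}\zeta_n$). A permutation is reduced if it has no fixed points and no dual fixed points. Removing a dual fixed point $i$ (an elementary reduction of the second kind) means: delete $i$ from its cycle in the cycle decomposition of $\alpha$ and replace every $j>i$ by $j-1$, obtaining a permutation of $\{1,\ldots,n-1\}$ (this is also allowed for $i=n$, when $\alpha(n)=1$). For a reduced permutation $\alpha$ and a pair $\{i,j\}\subseteq\{1,\ldots,n\}$ with $\alpha(i)=j+1$ and $\alpha(j)=i+1$, the directed edges $i\to\alpha(i)$ and $j\to\alpha(j)$ are called parallel edges. The removal of this pair of parallel edges from a reduced partition $\alpha$ means: form the permutation $\gamma_{i,j}[\alpha]$ given by $i\mapsto i+1$, $j\mapsto j+1$, and $k\mapsto\alpha(k)$ for $k\notin\{i,j\}$, and then remove its dual fixed points $i$ and $j$ (that is, delete $i$ and $j$ from the cycle decomposition of $\gamma_{i,j}[\alpha]$ and decrease each remaining label $k$ by the number of elements of $\{i,j\}$ that are smaller than $k$, obtaining a permutation of $\{1,\ldots,n-2\}$).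 A reduced partition is primitive if it has no pair of parallel edges. -}

module Defs where

open import Data.Fin.Base using (Fin; toℕ; punchIn; punchOut; _≤_; _<_)
open import Data.Fin.Permutation
  using (Permutation′; _⟨$⟩ʳ_; _∘ₚ_; _≈_; transpose; remove; punchIn-permute)
open import Data.Fin.Properties using (_≟_; punchInᵢ≢i)
open import Function.Bundles using (Injection)
open import Function.Properties.Inverse using (↔⇒↣)
open import Data.List.Base using (iterate)
open import Data.List.Relation.Unary.All using (All)
open import Data.List.Relation.Unary.Linked using (Linked)
open import Data.Nat.Base using (ℕ; suc; 2+)
import Data.Nat.Base as ℕ
open import Data.Nat.DivMod using (_mod_)
open import Data.Nat.GeneralisedArithmetic using (fold)
open import Data.Product.Base using (∃; ∃-syntax; _,_)
open import Relation.Binary.Construct.Closure.ReflexiveTransitive using (Star)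
open import Relation.Binary.PropositionalEquality.Core
  using (_≡_; _≢_; refl; sym; trans; cong)
open import Relation.Nullary.Decidable using (yes; no)
open import Relation.Nullary.Negation using (¬_; contradiction)

-- The set {1,…,n} is represented by Fin n, the label i by the element of
-- value i - 1.  A permutation acts on labels by _⟨$⟩ʳ_.

-- The cyclic successor i ↦ i + 1 modulo n, that is, the cycle (1,2,…,n).
ζ : ∀ {n} → Fin n → Fin n
ζ {suc n} i = suc (toℕ i) mod suc n

-- k is the length of the cycle of α through i.
record CycleLength {n} (α : Permutation′ n) (i : Fin n) (k : ℕ) : Set where
  field
    positive : 0 ℕ.< k
    returns  : fold i (α ⟨$⟩ʳ_) k ≡ i
    first    : ∀ {l} → 0 ℕ.< l → l ℕ.< k → fold i (α ⟨$⟩ʳ_) l ≢ i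

-- iterate (α ⟨$⟩ʳ_) i k is the list i, α(i), …, αᵏ⁻¹(i): when k is the cycle
-- length, it is the cycle through i listed beginning with i.
IsPartition : ∀ {n} → Permutation′ n → Set
IsPartition {n} α = ∀ (i : Fin n) (k : ℕ) → CycleLength α i k →
  let cycle = iterate (α ⟨$⟩ʳ_) i k in
  All (i ≤_) cycle → Linked _<_ cycle

record IsReduced {n} (α : Permutation′ n) : Set where
  field
    no-fixed-point      : ∀ i → α ⟨$⟩ʳ i ≢ i
    no-dual-fixed-point : ∀ i → α ⟨$⟩ʳ i ≢ ζ i

record IsReducedPartition {n} (α : Permutation′ n) : Set where
  field
    partition : IsPartition α
    reduced   : IsReduced α

record Parallel {n} (α : Permutation′ n) (i j : Fin n) : Set where
  field
    distinct : i ≢ j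
    edge-i   : α ⟨$⟩ʳ i ≡ ζ j
    edge-j   : α ⟨$⟩ʳ j ≡ ζ i

record IsPrimitive {n} (α : Permutation′ n) : Set where
  field
    reducedPartition : IsReducedPartition α
    no-parallel      : ¬ (∃[ i ] ∃[ j ] Parallel α i j)

private
  transpose-1st : ∀ {n} (i j : Fin n) → transpose i j ⟨$⟩ʳ i ≡ j
  transpose-1st i j with i ≟ i
  ... | yes _  = refl
  ... | no i≢i = contradiction refl i≢i

  transpose-2nd : ∀ {n} (i j : Fin n) → transpose i j ⟨$⟩ʳ j ≡ i
  transpose-2nd i j with j ≟ i
  ... | yes j≡i = j≡i
  ... | no _ with j ≟ j
  ...   | yes _  = refl
  ...   | no j≢j = contradiction refl j≢j

  transpose-other : ∀ {n} {i j k : Fin n} → k ≢ i → k ≢ j →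
                    transpose i j ⟨$⟩ʳ k ≡ k
  transpose-other {i = i} {j} {k} k≢i k≢j with k ≟ i
  ... | yes k≡i = contradiction k≡i k≢i
  ... | no _ with k ≟ j
  ...   | yes k≡j = contradiction k≡j k≢j
  ...   | no _    = refl

-- Delete i from its cycle and close up the labels.  Composing α with the
-- transposition (i α(i)) on the left makes i a fixed point and sends α⁻¹(i)
-- to α(i); remove i then drops the label i on both sides.
delete : ∀ {n} → Fin (suc n) → Permutation′ (suc n) → Permutation′ n
delete i α = remove i (α ∘ₚ transpose i (α ⟨$⟩ʳ i))

module _ {n} (i : Fin (suc n)) (α : Permutation′ (suc n)) (k : Fin n) where
  private
    punchIn-delete : punchIn i (delete i α ⟨$⟩ʳ k) ≡
                     transpose i (α ⟨$⟩ʳ i) ⟨$⟩ʳ (α ⟨$⟩ʳ punchIn i k)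
    punchIn-delete = trans
      (cong (λ p → punchIn p (delete i α ⟨$⟩ʳ k))
            (sym (transpose-2nd i (α ⟨$⟩ʳ i))))
      (sym (punchIn-permute (α ∘ₚ transpose i (α ⟨$⟩ʳ i)) i k))

  delete-pred : α ⟨$⟩ʳ punchIn i k ≡ i →
                punchIn i (delete i α ⟨$⟩ʳ k) ≡ α ⟨$⟩ʳ i
  delete-pred eq = trans punchIn-delete
    (trans (cong (transpose i (α ⟨$⟩ʳ i) ⟨$⟩ʳ_) eq) (transpose-1st i _))

  delete-other : α ⟨$⟩ʳ punchIn i k ≢ i →
                 punchIn i (delete i α ⟨$⟩ʳ k) ≡ α ⟨$⟩ʳ punchIn i k
  delete-other neq = trans punchIn-delete
    (transpose-other neq λ eq → punchInᵢ≢i i k (injective eq))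
    where
    injective = Injection.injective (↔⇒↣ α)

-- The map i ↦ α(j), j ↦ α(i), k ↦ α(k) otherwise.  For parallel edges this
-- is i ↦ i + 1, j ↦ j + 1, as γ-i, γ-j and γ-other record.
γ : ∀ {n} → Fin n → Fin n → Permutation′ n → Permutation′ n
γ i j α = transpose i j ∘ₚ α

module _ {n} {α : Permutation′ n} {i j : Fin n} (p : Parallel α i j) where
  open Parallel p

  γ-i : γ i j α ⟨$⟩ʳ i ≡ ζ i
  γ-i = trans (cong (α ⟨$⟩ʳ_) (transpose-1st i j)) edge-j

  γ-j : γ i j α ⟨$⟩ʳ j ≡ ζ j
  γ-j = trans (cong (α ⟨$⟩ʳ_) (transpose-2nd i j)) edge-i

  γ-other : ∀ {k} → k ≢ i → k ≢ j → γ i j α ⟨$⟩ʳ k ≡ α ⟨$⟩ʳ k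
  γ-other k≢i k≢j = cong (α ⟨$⟩ʳ_) (transpose-other k≢i k≢j)

-- After i is deleted, the label of j is punchOut i≢j.
removePair : ∀ {n} (α : Permutation′ (2+ n)) {i j} → i ≢ j → Permutation′ n
removePair α {i} {j} i≢j = delete (punchOut i≢j) (delete i (γ i j α))

infix 4 _⟶_ _⟶*_ _≋_

-- Removal of one pair of parallel edges from a reduced partition.
data _⟶_ : ∃ Permutation′ → ∃ Permutation′ → Set where
  removal : ∀ {n} {α : Permutation′ (2+ n)} {i j} →
            IsReducedPartition α → (p : Parallel α i j) →
            (2+ n , α) ⟶ (n , removePair α (Parallel.distinct p))

_⟶*_ : ∃ Permutation′ → ∃ Permutation′ → Set
_⟶*_ = Star _⟶_

-- Equality of permutations of possibly different sizes: the sizes agree and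
-- the permutations agree pointwise.
data _≋_ : ∃ Permutation′ → ∃ Permutation′ → Set where
  equal : ∀ {n} {α β : Permutation′ n} → α ≈ β → (n , α) ≋ (n , β)

{-# OPTIONS --safe #-}
-- Put β = α⁻¹ζ.  Fixed points of β are the dual fixed points of α, and pairs
-- of parallel edges are exactly the 2-cycles of β.  Removing a pair restricts
-- β to the complement of its 2-cycle and relabels monotonically.  Hence any
-- sequence of removals ending in a primitive partition restricts β to the
-- labels outside all of its 2-cycles; the order does not matter, because a
-- monotone relabelling is determined by its range and α by β.
--
-- That the result is again a partition is seen from the cyclic order: α is a
-- partition iff no element of the cycle of x lies strictly between x and α(x).
-- This forces parallel edges into two different cycles, which γ concatenates.

module Submission where

open import Defs
open import Data.Nat.Base using (ℕ; _≤_)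
open import Data.Fin.Permutation using (Permutation′)
open import Data.Product.Base using (_×_; _,_; Σ-syntax)

open import Data.Fin.Base as Fin using (Fin; zero; suc; toℕ; fromℕ; inject₁; punchIn; punchOut)
open import Data.Fin.Permutation as Perm using (_⟨$⟩ʳ_; _⟨$⟩ˡ_; _≈_)
open import Data.Fin.Properties as Finₚ using (_≟_; toℕ-injective; toℕ<n; punchInᵢ≢i; punchIn-punchOut)
import Data.List.Base as List
open import Data.List.Relation.Unary.All using (All; []; _∷_)
open import Data.List.Relation.Unary.Linked using (Linked; []; [-]; _∷_)
open import Data.Nat.Base as ℕ using (zero; suc; 2+; z≤n; s≤s; z<s; s<s)
open import Data.Nat.DivMod using (m<n⇒m%n≡m; n%n≡0; m%n<n)
open import Data.Nat.GeneralisedArithmetic using (fold; fold-+)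
import Data.Nat.Properties as ℕₚ
open import Data.Product.Base using (∃; ∃-syntax; proj₁; proj₂)
open import Data.Sum.Base using (_⊎_; inj₁; inj₂)
open import Function.Base using (_∘_; id)
open import Function.Bundles using (Injection)
open import Function.Properties.Inverse using (↔⇒↣)
open import Level using (0ℓ)
open import Relation.Binary.Construct.Closure.ReflexiveTransitive using (ε; _◅_)
open import Relation.Binary.Core using (Rel)
open import Relation.Binary.Definitions using (tri<; tri≈; tri>)
open import Relation.Binary.PropositionalEquality
  using (_≡_; _≢_; refl; sym; trans; cong; subst; subst₂)
open import Relation.Binary.Structures using (IsEquivalence)
open import Relation.Nullary.Decidable using (yes; no; toSum)
open import Relation.Nullary.Negation using (¬_; contradiction)
open import Relation.Unary using (Pred; Decidable)

private
  variable
    m n : ℕ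

-- Strictly monotone maps between finite sets of labels

StrictlyMonotone : (Fin m → Fin n) → Set
StrictlyMonotone e = ∀ {x y} → x Fin.< y → e x Fin.< e y

strictlyMonotone⇒injective : {e : Fin m → Fin n} → StrictlyMonotone e →
                             ∀ {x y} → e x ≡ e y → x ≡ y
strictlyMonotone⇒injective mono {x} {y} eq with Finₚ.<-cmp x y
... | tri< x<y _ _ = contradiction (mono x<y) (Finₚ.<-irrefl eq)
... | tri≈ _ x≡y _ = x≡y
... | tri> _ _ y<x = contradiction (mono y<x) (Finₚ.<-irrefl (sym eq))

strictlyMonotone⇒reflects-< : {e : Fin m → Fin n} → StrictlyMonotone e →
                              ∀ {x y} → e x Fin.< e y → x Fin.< y
strictlyMonotone⇒reflects-< {e = e} mono {x} {y} ex<ey with Finₚ.<-cmp x y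
... | tri< x<y _ _  = x<y
... | tri≈ _ refl _ = contradiction ex<ey (ℕₚ.<-irrefl refl)
... | tri> _ _ y<x  = contradiction ex<ey (ℕₚ.<-asym (mono y<x))

strictlyMonotone⇒inflationary : {e : Fin m → Fin n} → StrictlyMonotone e →
                                ∀ x → x Fin.≤ e x
strictlyMonotone⇒inflationary {e = e} mono x = go x (toℕ x) refl
  where
  -- The value `k` carries the recursion, since the predecessor `inject₁ y` is not a subterm of
  -- `suc y`.
  go : ∀ y k → toℕ y ≡ k → y Fin.≤ e y
  go zero    _       _  = z≤n
  go (suc y) (suc k) eq = ℕₚ.≤-<-trans
    (ℕₚ.≤-trans (ℕₚ.≤-reflexive (sym (Finₚ.toℕ-inject₁ y)))
      (go (inject₁ y) k (trans (Finₚ.toℕ-inject₁ y) (ℕₚ.suc-injective eq))))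
    (mono (Finₚ.≤̄⇒inject₁< (ℕₚ.≤-refl {toℕ y})))

punchIn-strictlyMonotone : (i : Fin (suc n)) → StrictlyMonotone (punchIn i)
punchIn-strictlyMonotone i {x} {y} x<y =
  ℕₚ.≰⇒> λ le → ℕₚ.<⇒≱ x<y (Finₚ.punchIn-cancel-≤ i y x le)

-- The transition maps between the two domains are strictly monotone and mutually inverse. A
-- strictly monotone map never lowers a value, so neither of them can raise one, and both preserve
-- values.
sameRange⇒≡ : {m′ : ℕ} {e : Fin m → Fin n} {e′ : Fin m′ → Fin n} →
              StrictlyMonotone e → StrictlyMonotone e′ →
              (∀ x → ∃[ y ] e′ y ≡ e x) → (∀ y → ∃[ x ] e x ≡ e′ y) →
              Σ[ m≡m′ ∈ m ≡ m′ ] (∀ x → e x ≡ e′ (subst Fin m≡m′ x))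
sameRange⇒≡ {m} {n} {m′} {e} {e′} mono mono′ to from = sizes , λ x → agree sizes x
  where
  to-mono : StrictlyMonotone (proj₁ ∘ to)
  to-mono {x} {y} x<y = strictlyMonotone⇒reflects-< mono′
    (subst₂ Fin._<_ (sym (proj₂ (to x))) (sym (proj₂ (to y))) (mono x<y))

  from-mono : StrictlyMonotone (proj₁ ∘ from)
  from-mono {x} {y} x<y = strictlyMonotone⇒reflects-< mono
    (subst₂ Fin._<_ (sym (proj₂ (from x))) (sym (proj₂ (from y))) (mono′ x<y))

  from-to : ∀ x → proj₁ (from (proj₁ (to x))) ≡ x
  from-to x = strictlyMonotone⇒injective mono
    (trans (proj₂ (from (proj₁ (to x)))) (proj₂ (to x)))

  to-value : ∀ x → toℕ (proj₁ (to x)) ≡ toℕ x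
  to-value x = ℕₚ.≤-antisym
    (subst (proj₁ (to x) Fin.≤_) (from-to x)
      (strictlyMonotone⇒inflationary from-mono (proj₁ (to x))))
    (strictlyMonotone⇒inflationary to-mono x)

  sizes : m ≡ m′
  sizes = ℕₚ.≤-antisym (Finₚ.injective⇒≤ (strictlyMonotone⇒injective to-mono))
                       (Finₚ.injective⇒≤ (strictlyMonotone⇒injective from-mono))

  agree : (eq : m ≡ m′) → ∀ x → e x ≡ e′ (subst Fin eq x)
  agree refl x = trans (sym (proj₂ (to x))) (cong e′ (toℕ-injective (to-value x)))

⟨$⟩ʳ-injective : (α : Permutation′ n) → ∀ {x y} → α ⟨$⟩ʳ x ≡ α ⟨$⟩ʳ y → x ≡ y
⟨$⟩ʳ-injective α = Injection.injective (↔⇒↣ α)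

-- The cyclic order and the cyclic successor

-- The strict cyclic order: walking upwards from `x` and wrapping round, `y` is met before `z`. The
-- disjuncts say where the wrap falls.
Cyclic : Fin n → Fin n → Fin n → Set
Cyclic x y z = (x Fin.< y × y Fin.< z) ⊎ (y Fin.< z × z Fin.< x) ⊎ (z Fin.< x × x Fin.< y)

Cyclic-rotate : {x y z : Fin n} → Cyclic x y z → Cyclic y z x
Cyclic-rotate (inj₁ p)        = inj₂ (inj₂ p)
Cyclic-rotate (inj₂ (inj₁ p)) = inj₁ p
Cyclic-rotate (inj₂ (inj₂ p)) = inj₂ (inj₁ p)

Cyclic-asym : {x y z : Fin n} → Cyclic x y z → ¬ Cyclic x z y
Cyclic-asym (inj₁ (a , b))        (inj₁ (c , d))        = ℕₚ.<-asym b d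
Cyclic-asym (inj₁ (a , b))        (inj₂ (inj₁ (c , d))) = ℕₚ.<-asym b c
Cyclic-asym (inj₁ (a , b))        (inj₂ (inj₂ (c , d))) = ℕₚ.<-asym a c
Cyclic-asym (inj₂ (inj₁ (a , b))) (inj₁ (c , d))        = ℕₚ.<-asym a d
Cyclic-asym (inj₂ (inj₁ (a , b))) (inj₂ (inj₁ (c , d))) = ℕₚ.<-asym a c
Cyclic-asym (inj₂ (inj₁ (a , b))) (inj₂ (inj₂ (c , d))) = ℕₚ.<-asym b d
Cyclic-asym (inj₂ (inj₂ (a , b))) (inj₁ (c , d))        = ℕₚ.<-asym a c
Cyclic-asym (inj₂ (inj₂ (a , b))) (inj₂ (inj₁ (c , d))) = ℕₚ.<-asym b d
Cyclic-asym (inj₂ (inj₂ (a , b))) (inj₂ (inj₂ (c , d))) = ℕₚ.<-asym b c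

-- Cutting the circle at `x` leaves a linear order on the other labels, and this is its
-- transitivity. Rotations move the cut elsewhere.
Cyclic-trans : {x y z w : Fin n} → Cyclic x y z → Cyclic x z w → Cyclic x y w
Cyclic-trans (inj₁ (a , b))        (inj₁ (c , d))        = inj₁ (a , ℕₚ.<-trans b d)
Cyclic-trans (inj₁ (a , b))        (inj₂ (inj₁ (c , d))) = inj₂ (inj₂ (d , a))
Cyclic-trans (inj₁ (a , b))        (inj₂ (inj₂ (c , d))) = inj₂ (inj₂ (c , a))
Cyclic-trans (inj₂ (inj₁ (a , b))) (inj₁ (c , d))        = contradiction b (ℕₚ.<-asym c)
Cyclic-trans (inj₂ (inj₁ (a , b))) (inj₂ (inj₁ (c , d))) = inj₂ (inj₁ (ℕₚ.<-trans a c , d))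
Cyclic-trans (inj₂ (inj₁ (a , b))) (inj₂ (inj₂ (c , d))) = contradiction b (ℕₚ.<-asym d)
Cyclic-trans (inj₂ (inj₂ (a , b))) (inj₁ (c , d))        = contradiction a (ℕₚ.<-asym c)
Cyclic-trans (inj₂ (inj₂ (a , b))) (inj₂ (inj₁ (c , d))) = inj₂ (inj₂ (d , b))
Cyclic-trans (inj₂ (inj₂ (a , b))) (inj₂ (inj₂ (c , d))) = inj₂ (inj₂ (c , b))

Cyclic-total : {x y z : Fin n} → x ≢ y → y ≢ z → x ≢ z → Cyclic x y z ⊎ Cyclic x z y
Cyclic-total {x = x} {y} {z} x≢y y≢z x≢z
  with Finₚ.<-cmp x y | Finₚ.<-cmp y z | Finₚ.<-cmp x z
... | tri≈ _ eq _ | _           | _           = contradiction eq x≢y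
... | tri< _ _ _  | tri≈ _ eq _ | _           = contradiction eq y≢z
... | tri> _ _ _  | tri≈ _ eq _ | _           = contradiction eq y≢z
... | tri< _ _ _  | tri< _ _ _  | tri≈ _ eq _ = contradiction eq x≢z
... | tri< _ _ _  | tri> _ _ _  | tri≈ _ eq _ = contradiction eq x≢z
... | tri> _ _ _  | tri< _ _ _  | tri≈ _ eq _ = contradiction eq x≢z
... | tri> _ _ _  | tri> _ _ _  | tri≈ _ eq _ = contradiction eq x≢z
... | tri< a _ _  | tri< b _ _  | tri< _ _ _  = inj₁ (inj₁ (a , b))
... | tri< a _ _  | tri< b _ _  | tri> _ _ _  = inj₁ (inj₁ (a , b))
... | tri< a _ _  | tri> _ _ b  | tri< c _ _  = inj₂ (inj₁ (c , b))
... | tri< a _ _  | tri> _ _ b  | tri> _ _ c  = inj₁ (inj₂ (inj₂ (c , a)))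
... | tri> _ _ a  | tri< b _ _  | tri< c _ _  = inj₂ (inj₂ (inj₂ (a , c)))
... | tri> _ _ a  | tri< b _ _  | tri> _ _ c  = inj₁ (inj₂ (inj₁ (b , c)))
... | tri> _ _ a  | tri> _ _ b  | _           = inj₂ (inj₂ (inj₁ (b , a)))

Cyclic-distinct : {x y z : Fin n} → Cyclic x y z → x ≢ y
Cyclic-distinct (inj₁ (a , b))        refl = ℕₚ.<-irrefl refl a
Cyclic-distinct (inj₂ (inj₁ (a , b))) refl = ℕₚ.<-asym a b
Cyclic-distinct (inj₂ (inj₂ (a , b))) refl = ℕₚ.<-irrefl refl b

Cyclic-embed : {e : Fin m → Fin n} → StrictlyMonotone e →
               ∀ {x y z} → Cyclic x y z → Cyclic (e x) (e y) (e z)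
Cyclic-embed mono (inj₁ (a , b))        = inj₁ (mono a , mono b)
Cyclic-embed mono (inj₂ (inj₁ (a , b))) = inj₂ (inj₁ (mono a , mono b))
Cyclic-embed mono (inj₂ (inj₂ (a , b))) = inj₂ (inj₂ (mono a , mono b))

ζ-step : (x : Fin n) → suc (toℕ x) ℕ.< n → toℕ (ζ x) ≡ suc (toℕ x)
ζ-step {suc n} x x+1<n = trans (Finₚ.toℕ-fromℕ< (m%n<n (suc (toℕ x)) (suc n))) (m<n⇒m%n≡m x+1<n)

ζ-last : (x : Fin n) → suc (toℕ x) ≡ n → toℕ (ζ x) ≡ 0
ζ-last {suc n} x x+1≡n = trans (Finₚ.toℕ-fromℕ< (m%n<n (suc (toℕ x)) (suc n)))
  (trans (cong (ℕ._% suc n) x+1≡n) (n%n≡0 (suc n)))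

step-or-last : (x : Fin n) → suc (toℕ x) ℕ.< n ⊎ suc (toℕ x) ≡ n
step-or-last x = ℕₚ.m≤n⇒m<n∨m≡n (toℕ<n x)

ζ-injective : {x y : Fin n} → ζ x ≡ ζ y → x ≡ y
ζ-injective {x = x} {y} eq with step-or-last x | step-or-last y
... | inj₁ p | inj₁ q = toℕ-injective (ℕₚ.suc-injective
  (trans (sym (ζ-step x p)) (trans (cong toℕ eq) (ζ-step y q))))
... | inj₁ p | inj₂ q = contradiction
  (trans (sym (ζ-step x p)) (trans (cong toℕ eq) (ζ-last y q))) λ ()
... | inj₂ p | inj₁ q = contradiction
  (trans (sym (ζ-step y q)) (trans (cong toℕ (sym eq)) (ζ-last x p))) λ ()
... | inj₂ p | inj₂ q = toℕ-injective (ℕₚ.suc-injective (trans p (sym q)))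

ζ-surjective : (y : Fin n) → ∃[ x ] ζ x ≡ y
ζ-surjective {suc n} zero =
  fromℕ n , toℕ-injective (ζ-last (fromℕ n) (cong suc (Finₚ.toℕ-fromℕ n)))
ζ-surjective {suc n} (suc y) = inject₁ y , toℕ-injective
  (trans (ζ-step (inject₁ y) (s<s (Finₚ.inject₁ℕ< y))) (cong suc (Finₚ.toℕ-inject₁ y)))

ζ-moves : (x : Fin (2+ n)) → ζ x ≢ x
ζ-moves x eq with step-or-last x
... | inj₁ p = contradiction (trans (sym (ζ-step x p)) (cong toℕ eq)) ℕₚ.1+n≢n
... | inj₂ q = contradiction
  (trans (cong suc (trans (sym (ζ-last x q)) (cong toℕ eq))) q) λ ()

¬Cyclic-ζ : (x y : Fin n) → ¬ Cyclic x y (ζ x)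
¬Cyclic-ζ x y c with step-or-last x
¬Cyclic-ζ x y c | inj₁ p with ζ x | ζ-step x p
¬Cyclic-ζ x y (inj₁ (a , b))        | inj₁ p | z | eq = ℕₚ.<⇒≱ b (subst (ℕ._≤ toℕ y) (sym eq) a)
¬Cyclic-ζ x y (inj₂ (inj₁ (a , b))) | inj₁ p | z | eq =
  ℕₚ.<-asym b (subst (toℕ x ℕ.<_) (sym eq) (ℕₚ.n<1+n _))
¬Cyclic-ζ x y (inj₂ (inj₂ (a , b))) | inj₁ p | z | eq =
  ℕₚ.<-asym a (subst (toℕ x ℕ.<_) (sym eq) (ℕₚ.n<1+n _))
¬Cyclic-ζ x y c | inj₂ q with ζ x | ζ-last x q
¬Cyclic-ζ x y (inj₁ (a , b))        | inj₂ q | z | eq = ℕₚ.n≮0 (subst (toℕ y ℕ.<_) eq b)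
¬Cyclic-ζ x y (inj₂ (inj₁ (a , b))) | inj₂ q | z | eq = ℕₚ.n≮0 (subst (toℕ y ℕ.<_) eq a)
¬Cyclic-ζ x y (inj₂ (inj₂ (a , b))) | inj₂ q | z | eq =
  ℕₚ.<⇒≱ (toℕ<n y) (subst (ℕ._≤ toℕ y) q b)

toℕ-punchIn-< : (i : Fin (suc n)) (x : Fin n) → toℕ x ℕ.< toℕ i → toℕ (punchIn i x) ≡ toℕ x
toℕ-punchIn-< (suc i) zero    _         = refl
toℕ-punchIn-< (suc i) (suc x) (s<s x<i) = cong suc (toℕ-punchIn-< i x x<i)

toℕ-punchIn-≥ : (i : Fin (suc n)) (x : Fin n) → toℕ i ℕ.≤ toℕ x → toℕ (punchIn i x) ≡ suc (toℕ x)
toℕ-punchIn-≥ zero    x       _         = refl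
toℕ-punchIn-≥ (suc i) (suc x) (s≤s i≤x) = cong suc (toℕ-punchIn-≥ i x i≤x)

-- Deleting `i` short-circuits the cycle `ζ`: only the predecessor of `i` gets a new successor,
-- namely the old successor of `i`.
ζ-punchIn : (i : Fin (suc n)) (x : Fin n) →
            ζ (punchIn i x) ≡ punchIn i (ζ x) ⊎
            (ζ (punchIn i x) ≡ i × ζ i ≡ punchIn i (ζ x))
ζ-punchIn {n} i x with step-or-last x | ℕₚ.<-≤-connex (toℕ x) (toℕ i)
... | inj₁ p | inj₂ i≤x = inj₁ (toℕ-injective (trans
  (trans (ζ-step (punchIn i x) (subst (λ k → suc k ℕ.< suc n) (sym pin) (s<s p))) (cong suc pin))
  (sym (trans (toℕ-punchIn-≥ i (ζ x) (subst (toℕ i ℕ.≤_) (sym (ζ-step x p)) (ℕₚ.m≤n⇒m≤1+n i≤x)))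
              (cong suc (ζ-step x p))))))
  where pin = toℕ-punchIn-≥ i x i≤x
... | inj₁ p | inj₁ x<i = helper (ℕₚ.m≤n⇒m<n∨m≡n x<i)
  where
  ζpin : toℕ (ζ (punchIn i x)) ≡ suc (toℕ x)
  ζpin = trans (ζ-step (punchIn i x)
    (subst (λ k → suc k ℕ.< suc n) (sym (toℕ-punchIn-< i x x<i)) (ℕₚ.m<n⇒m<1+n p)))
    (cong suc (toℕ-punchIn-< i x x<i))
  helper : suc (toℕ x) ℕ.< toℕ i ⊎ suc (toℕ x) ≡ toℕ i →
           ζ (punchIn i x) ≡ punchIn i (ζ x) ⊎
           (ζ (punchIn i x) ≡ i × ζ i ≡ punchIn i (ζ x))
  helper (inj₁ x+1<i) = inj₁ (toℕ-injective (trans ζpin (sym (trans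
    (toℕ-punchIn-< i (ζ x) (subst (ℕ._< toℕ i) (sym (ζ-step x p)) x+1<i)) (ζ-step x p)))))
  helper (inj₂ x+1≡i) = inj₂ (toℕ-injective (trans ζpin x+1≡i) , toℕ-injective (trans
    (ζ-step i (subst (λ k → suc k ℕ.< suc n) x+1≡i (s<s p)))
    (sym (trans (toℕ-punchIn-≥ i (ζ x) (ℕₚ.≤-reflexive (trans (sym x+1≡i) (sym (ζ-step x p)))))
                (cong suc (trans (ζ-step x p) x+1≡i))))))
-- Here `x` is the last remaining label and lies below `i`, so `i` is the top label and its
-- successor wraps to 0.
... | inj₂ q | inj₁ x<i = inj₂ (toℕ-injective (trans ζpin (trans q (sym i≡n))) ,
    toℕ-injective (trans (ζ-last i (cong suc i≡n))
      (sym (trans (toℕ-punchIn-< i (ζ x) (subst (ℕ._< toℕ i) (sym (ζ-last x q)) (ℕₚ.≤-<-trans z≤n x<i)))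
                  (ζ-last x q)))))
  where
  i≡n : toℕ i ≡ n
  i≡n = ℕₚ.≤-antisym (ℕ.s≤s⁻¹ (toℕ<n i)) (subst (ℕ._≤ toℕ i) q x<i)
  ζpin : toℕ (ζ (punchIn i x)) ≡ suc (toℕ x)
  ζpin = trans (ζ-step (punchIn i x)
    (subst (λ k → suc k ℕ.< suc n) (sym (toℕ-punchIn-< i x x<i)) (s<s (toℕ<n x))))
    (cong suc (toℕ-punchIn-< i x x<i))
... | inj₂ q | inj₂ i≤x = helper (ℕₚ.m≤n⇒m<n∨m≡n (z≤n {toℕ i}))
  where
  ζpin : toℕ (ζ (punchIn i x)) ≡ 0
  ζpin = ζ-last (punchIn i x) (cong suc (trans (toℕ-punchIn-≥ i x i≤x) q))
  helper : 0 ℕ.< toℕ i ⊎ 0 ≡ toℕ i →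
           ζ (punchIn i x) ≡ punchIn i (ζ x) ⊎
           (ζ (punchIn i x) ≡ i × ζ i ≡ punchIn i (ζ x))
  helper (inj₁ 0<i) = inj₁ (toℕ-injective (trans ζpin (sym (trans
    (toℕ-punchIn-< i (ζ x) (subst (ℕ._< toℕ i) (sym (ζ-last x q)) 0<i)) (ζ-last x q)))))
  helper (inj₂ 0≡i) = inj₂ (toℕ-injective (trans ζpin 0≡i) , toℕ-injective (trans
    (ζ-step i (subst (λ k → suc k ℕ.< suc n) 0≡i (s<s (ℕₚ.≤-<-trans z≤n (toℕ<n x)))))
    (sym (trans (toℕ-punchIn-≥ i (ζ x) (ℕₚ.≤-reflexive (trans (sym 0≡i) (sym (ζ-last x q)))))
                (cong suc (trans (ζ-last x q) 0≡i))))))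

-- Cycles and partitions

-- `iterate` applies `f` to the starting point, `fold` applies it outermost; this reconciles the
-- two.
fold-shift : {A : Set} (x : A) (f : A → A) (l : ℕ) → fold (f x) f l ≡ f (fold x f l)
fold-shift x f zero    = refl
fold-shift x f (suc l) = cong f (fold-shift x f l)

module _ {A : Set} {f : A → A} where

  All-iterate⁺ : {P : A → Set} → ∀ x k → (∀ l → l ℕ.< k → P (fold x f l)) →
                 All P (List.iterate f x k)
  All-iterate⁺ x zero    h = []
  All-iterate⁺ {P} x (suc k) h = h 0 z<s ∷ All-iterate⁺ (f x) k
    (λ l l<k → subst P (sym (fold-shift x f l)) (h (suc l) (s<s l<k)))

  All-iterate⁻ : {P : A → Set} → ∀ x k → All P (List.iterate f x k) →
                 ∀ l → l ℕ.< k → P (fold x f l)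
  All-iterate⁻ x (suc k) (p ∷ ps) zero    _         = p
  All-iterate⁻ {P} x (suc k) (p ∷ ps) (suc l) (s<s l<k) =
    subst P (fold-shift x f l) (All-iterate⁻ (f x) k ps l l<k)

  Linked-iterate⁺ : {R : Rel A 0ℓ} → ∀ x k →
                    (∀ l → suc l ℕ.< k → R (fold x f l) (fold x f (suc l))) →
                    Linked R (List.iterate f x k)
  Linked-iterate⁺ x zero          h = []
  Linked-iterate⁺ x (suc zero)    h = [-]
  Linked-iterate⁺ {R} x (suc (suc k)) h = h 0 (s<s z<s) ∷ Linked-iterate⁺ (f x) (suc k)
    (λ l l<k → subst₂ R (sym (fold-shift x f l)) (sym (fold-shift x f (suc l))) (h (suc l) (s<s l<k)))

  Linked-iterate⁻ : {R : Rel A 0ℓ} → ∀ x k → Linked R (List.iterate f x k) →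
                    ∀ l → suc l ℕ.< k → R (fold x f l) (fold x f (suc l))
  Linked-iterate⁻ x (suc (suc k)) (r ∷ rs) zero    _         = r
  Linked-iterate⁻ x (suc zero)    _        l       (s<s ())
  Linked-iterate⁻ {R} x (suc (suc k)) (r ∷ rs) (suc l) (s<s l<k) =
    subst₂ R (fold-shift x f l) (fold-shift x f (suc l)) (Linked-iterate⁻ (f x) (suc k) rs l l<k)

  fold-reduce : ∀ {x k} → 0 ℕ.< k → fold x f k ≡ x → ∀ t →
                ∃[ s ] s ℕ.< k × fold x f t ≡ fold x f s
  fold-reduce 0<k ret zero = 0 , 0<k , refl
  fold-reduce 0<k ret (suc t) with fold-reduce 0<k ret t
  ... | s , s<k , eq with ℕₚ.m≤n⇒m<n∨m≡n s<k
  ...   | inj₁ s+1<k = suc s , s+1<k , cong f eq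
  ...   | inj₂ refl  = 0 , 0<k , trans (cong f eq) ret

least : {P : Pred ℕ 0ℓ} → Decidable P → ∀ k → P k →
        ∃[ l ] P l × (∀ {j} → j ℕ.< l → ¬ P j)
least {P} P? k pk = go k 0 (ℕₚ.+-identityʳ k) λ ()
  where
  -- An upward search from 0, with `d` the distance left to the known witness `k`.
  go : ∀ d l → d ℕ.+ l ≡ k → (∀ {j} → j ℕ.< l → ¬ P j) → ∃[ l ] P l × (∀ {j} → j ℕ.< l → ¬ P j)
  go d l eq none with P? l
  ... | yes pl = l , pl , none
  go zero    l eq none | no ¬pl = contradiction (subst P (sym eq) pk) ¬pl
  go (suc d) l eq none | no ¬pl = go d (suc l) (trans (ℕₚ.+-suc d l) eq) λ {j} j<1+l →
    λ pj → case-≤ (ℕₚ.m≤n⇒m<n∨m≡n (ℕ.s≤s⁻¹ j<1+l)) pj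
    where
    case-≤ : ∀ {j} → j ℕ.< l ⊎ j ≡ l → ¬ P j
    case-≤ (inj₁ j<l)  = none j<l
    case-≤ (inj₂ refl) = ¬pl

argmin : (g : ℕ → Fin n) → ∀ k → ∃[ a ] (∀ l → l ℕ.< suc k → g a Fin.≤ g l)
argmin g zero = 0 , λ { zero _ → ℕₚ.≤-refl ; (suc l) (s<s ()) }
argmin g (suc k) with argmin g k
... | a , min with ℕₚ.≤-total (toℕ (g a)) (toℕ (g (suc k)))
...   | inj₁ le = a , λ l l<k → case (ℕₚ.m≤n⇒m<n∨m≡n (ℕ.s≤s⁻¹ l<k))
  where
  case : ∀ {l} → l ℕ.< suc k ⊎ l ≡ suc k → g a Fin.≤ g l
  case (inj₁ p)    = min _ p
  case (inj₂ refl) = le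
...   | inj₂ ge = suc k , λ l l<k → case (ℕₚ.m≤n⇒m<n∨m≡n (ℕ.s≤s⁻¹ l<k))
  where
  case : ∀ {l} → l ℕ.< suc k ⊎ l ≡ suc k → g (suc k) Fin.≤ g l
  case (inj₁ p)    = ℕₚ.≤-trans ge (min _ p)
  case (inj₂ refl) = ℕₚ.≤-refl

module _ (α : Permutation′ n) where
  private
    f = α ⟨$⟩ʳ_

  fold-injective : ∀ {x y} t → fold x f t ≡ fold y f t → x ≡ y
  fold-injective zero    eq = eq
  fold-injective (suc t) eq = fold-injective t (⟨$⟩ʳ-injective α eq)

  -- Two of the first n + 1 iterates coincide, and cancelling the shorter power leaves a return to
  -- `x` after at least one step.
  recurs : ∀ x → ∃[ k ] fold x f (suc k) ≡ x
  recurs x with Finₚ.pigeonhole (ℕₚ.n<1+n n) (λ t → fold x f (toℕ t))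
  ... | i , j , i<j , eq with d , refl′ ← ℕₚ.m≤n⇒∃[o]m+o≡n i<j = d , sym (fold-injective (toℕ i)
    (trans eq (trans (cong (fold x f) (trans (sym refl′) (sym (ℕₚ.+-suc (toℕ i) d))))
                     (fold-+ x f (toℕ i)))))

  cycleLength : ∀ x → ∃[ k ] CycleLength α x k
  cycleLength x with least (λ k → fold x f (suc k) ≟ x) (proj₁ (recurs x)) (proj₂ (recurs x))
  ... | k , ret , first = suc k , record
    { positive = z<s ; returns = ret ; first = λ { {suc l} _ (s<s l<k) → first l<k } }

  Orbit : Rel (Fin n) 0ℓ
  Orbit x y = ∃[ t ] fold x f t ≡ y

  orbit-trans : ∀ {x y z} → Orbit x y → Orbit y z → Orbit x z
  orbit-trans {x} (s , refl) (t , refl) = t ℕ.+ s , fold-+ x f t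

  -- `Orbit` allows forward steps only; a single step is undone by going on round the cycle until it
  -- returns.
  orbit-sym : ∀ {x y} → Orbit x y → Orbit y x
  orbit-sym {x} (zero  , refl) = 0 , refl
  orbit-sym {x} (suc s , refl) = orbit-trans (back (fold x f s)) (orbit-sym (s , refl))
    where
    back : ∀ y → Orbit (f y) y
    back y with recurs y
    ... | k , ret = k , trans (fold-shift y f k) ret

  orbit-isEquivalence : IsEquivalence Orbit
  orbit-isEquivalence = record
    { refl = 0 , refl ; sym = orbit-sym ; trans = orbit-trans }

  cycleMin : ∀ x → ∃[ a ] Orbit x a × (∀ t → a Fin.≤ fold a f t)
  cycleMin x with recurs x
  ... | k , ret with argmin (fold x f) k
  ...   | a , min = fold x f a , (a , refl) , λ t →
    let s , s<k , eq = fold-reduce z<s ret (t ℕ.+ a)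
    in ℕₚ.≤-trans (min s s<k) (ℕₚ.≤-reflexive (cong toℕ (trans (sym eq) (fold-+ x f t))))

-- The rotation-invariant form of being a partition: no element of the
-- block of x lies strictly inside the cyclic interval from x to α(x).
record IsCyclicPartition (α : Permutation′ n) : Set₁ where
  field
    _∼_           : Rel (Fin n) 0ℓ
    ∼-equivalence : IsEquivalence _∼_
    invariant     : ∀ x → x ∼ (α ⟨$⟩ʳ x)
    increasing    : ∀ {x y} → x ∼ y → ¬ Cyclic x y (α ⟨$⟩ʳ x)

  open IsEquivalence ∼-equivalence public
    renaming (refl to ∼-refl; sym to ∼-sym; trans to ∼-trans)
    using ()

-- Listed from its least element `a`, the cycle increases, so none of its elements lies between two
-- consecutive ones. The closing step runs from the largest element to the least, and nothing of the
-- cycle lies beyond either.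
partition⇒cyclicPartition : (α : Permutation′ n) → IsPartition α → IsCyclicPartition α
partition⇒cyclicPartition {n} α part = record
  { _∼_           = Orbit α
  ; ∼-equivalence = orbit-isEquivalence α
  ; invariant     = λ x → 1 , refl
  ; increasing    = increasing
  }
  where
  f = α ⟨$⟩ʳ_

  increasing : ∀ {x y} → Orbit α x y → ¬ Cyclic x y (f x)
  increasing {x} {y} x∼y c
    with a , x∼a , min ← cycleMin α x
    with k , len ← cycleLength α a
    with s , refl ← orbit-sym α x∼a
    with t , refl ← orbit-trans α (orbit-sym α x∼a) x∼y
    with s , s<k , eqs ← fold-reduce (CycleLength.positive len) (CycleLength.returns len) s
    with t , t<k , eqt ← fold-reduce (CycleLength.positive len) (CycleLength.returns len) t
    = go (subst₂ (λ u v → Cyclic u v (f u)) eqs eqt c)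
    where
    ascent : ∀ l → suc l ℕ.< k → fold a f l Fin.< fold a f (suc l)
    ascent = Linked-iterate⁻ a k (part a k len (All-iterate⁺ a k (λ l _ → min l)))

    mono : ∀ l d → d ℕ.+ l ℕ.< k → fold a f l Fin.≤ fold a f (d ℕ.+ l)
    mono l zero    p = ℕₚ.≤-refl
    mono l (suc d) p = ℕₚ.≤-trans (mono l d (ℕₚ.<-trans (ℕₚ.n<1+n _) p)) (ℕₚ.<⇒≤ (ascent (d ℕ.+ l) p))

    mono-≤ : ∀ l l′ → l ℕ.≤ l′ → l′ ℕ.< k → fold a f l Fin.≤ fold a f l′
    mono-≤ l l′ l≤l′ l′<k with d , eq ← ℕₚ.m≤n⇒∃[o]m+o≡n l≤l′
      rewrite sym eq | ℕₚ.+-comm l d = mono l d l′<k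

    go : ¬ Cyclic (fold a f s) (fold a f t) (fold a f (suc s))
    go c with ℕₚ.m≤n⇒m<n∨m≡n s<k
    go (inj₁ (p , q)) | inj₁ s+1<k with ℕₚ.≤-<-connex t s
    ... | inj₁ t≤s = ℕₚ.<⇒≱ p (mono-≤ t s t≤s s<k)
    ... | inj₂ s<t = ℕₚ.<⇒≱ q (mono-≤ (suc s) t s<t t<k)
    go (inj₂ (inj₁ (p , q))) | inj₁ s+1<k = ℕₚ.<-asym q (ascent s s+1<k)
    go (inj₂ (inj₂ (p , q))) | inj₁ s+1<k = ℕₚ.<-asym p (ascent s s+1<k)
    -- The exponent `s` is the last one of the cycle, so the next iterate is `a` itself.
    go c | inj₂ refl with fold a f (suc s) | CycleLength.returns len
    go (inj₁ (p , q))        | inj₂ refl | _ | refl = ℕₚ.<⇒≱ q (min t)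
    go (inj₂ (inj₁ (p , q))) | inj₂ refl | _ | refl = ℕₚ.<⇒≱ p (min t)
    go (inj₂ (inj₂ (p , q))) | inj₂ refl | _ | refl = ℕₚ.<⇒≱ q (mono-≤ t s (ℕ.s≤s⁻¹ t<k) s<k)

-- Before the cycle closes, a descent would place its least element `i` strictly inside the cyclic
-- interval of one step. Two equal neighbours would make `i` a fixed point and the cycle shorter
-- than `k`.
cyclicPartition⇒partition : (α : Permutation′ n) → IsCyclicPartition α → IsPartition α
cyclicPartition⇒partition α cp i k len all = Linked-iterate⁺ i k ascent
  where
  open IsCyclicPartition cp
  f = α ⟨$⟩ʳ_

  lower : ∀ l → l ℕ.< k → i Fin.≤ fold i f l
  lower = All-iterate⁻ i k all

  reachable : ∀ l → i ∼ fold i f l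
  reachable zero    = ∼-refl
  reachable (suc l) = ∼-trans (reachable l) (invariant _)

  ascent : ∀ l → suc l ℕ.< k → fold i f l Fin.< fold i f (suc l)
  ascent l l<k with Finₚ.<-cmp (fold i f l) (fold i f (suc l))
  ... | tri< p _ _ = p
  ... | tri≈ _ eq _ = contradiction
    (sym (fold-injective α l (trans eq (sym (fold-shift i f l)))))
    (CycleLength.first len z<s (ℕₚ.≤-<-trans (s≤s z≤n) l<k))
  ... | tri> _ _ q = contradiction
    (inj₂ (inj₁ (Finₚ.≤∧≢⇒< (lower (suc l) l<k) (CycleLength.first len z<s l<k ∘ sym) , q)))
    (increasing (∼-sym (reachable l)))

-- Deleting a label

-- Unlike _≟_, this does not occur inside transpose, so that a with on it
-- leaves the permutations in the goal folded.
≡-or-≢ : (x y : Fin n) → x ≡ y ⊎ x ≢ y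
≡-or-≢ x y = toSum (x ≟ y)

delete-cases : ∀ (i : Fin (suc n)) (α : Permutation′ (suc n)) x →
  punchIn i (delete i α ⟨$⟩ʳ x) ≡ α ⟨$⟩ʳ punchIn i x ⊎
  (α ⟨$⟩ʳ punchIn i x ≡ i × punchIn i (delete i α ⟨$⟩ʳ x) ≡ α ⟨$⟩ʳ i)
delete-cases i α x with ≡-or-≢ (α ⟨$⟩ʳ punchIn i x) i
... | inj₁ eq  = inj₂ (eq , delete-pred i α x eq)
... | inj₂ neq = inj₁ (delete-other i α x neq)

delete-fixed : ∀ (i : Fin (suc n)) (α : Permutation′ (suc n)) {x} → delete i α ⟨$⟩ʳ x ≡ x →
  α ⟨$⟩ʳ punchIn i x ≡ punchIn i x ⊎ (α ⟨$⟩ʳ punchIn i x ≡ i × α ⟨$⟩ʳ i ≡ punchIn i x)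
delete-fixed i α {x} fixed with delete-cases i α x
... | inj₁ eq          = inj₁ (trans (sym eq) (cong (punchIn i) fixed))
... | inj₂ (pred , eq) = inj₂ (pred , trans (sym eq) (cong (punchIn i) fixed))

-- The only new edge joins the predecessor of `i` to `α(i)`. A label of the block strictly inside
-- its interval would lie inside one of the two old edges meeting at `i`.
delete-cyclicPartition : ∀ (i : Fin (suc n)) {α : Permutation′ (suc n)} →
                         IsCyclicPartition α → IsCyclicPartition (delete i α)
delete-cyclicPartition i {α} cp = record
  { _∼_           = λ x y → punchIn i x ∼ punchIn i y
  ; ∼-equivalence = record { refl = ∼-refl ; sym = ∼-sym ; trans = ∼-trans }
  ; invariant     = invariant′
  ; increasing    = λ x∼y c → increasing′ x∼y (Cyclic-embed (punchIn-strictlyMonotone i) c)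
  }
  where
  open IsCyclicPartition cp

  invariant′ : ∀ x → punchIn i x ∼ punchIn i (delete i α ⟨$⟩ʳ x)
  invariant′ x with delete-cases i α x
  ... | inj₁ eq          = subst (punchIn i x ∼_) (sym eq) (invariant _)
  ... | inj₂ (pred , eq) = subst (punchIn i x ∼_) (sym eq)
    (∼-trans (subst (punchIn i x ∼_) pred (invariant _)) (invariant i))

  increasing′ : ∀ {x y} → punchIn i x ∼ punchIn i y →
                ¬ Cyclic (punchIn i x) (punchIn i y) (punchIn i (delete i α ⟨$⟩ʳ x))
  increasing′ {x} {y} x∼y c with delete-cases i α x
  ... | inj₁ eq = increasing x∼y (subst (Cyclic _ _) eq c)
  ... | inj₂ (pred , eq)
    with Cyclic-total (Cyclic-distinct c) (punchInᵢ≢i i y) (punchInᵢ≢i i x)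
  ...   | inj₁ xyi = increasing x∼y (subst (Cyclic _ _) (sym pred) xyi)
  ...   | inj₂ xiy = increasing
    (∼-trans (∼-sym (subst (punchIn i x ∼_) pred (invariant _))) x∼y)
    (subst (Cyclic i _) eq
      (Cyclic-rotate (Cyclic-rotate
        (Cyclic-trans (Cyclic-rotate c) (Cyclic-rotate (Cyclic-rotate xiy))))))

-- The dual permutation and its restrictions

dual : Permutation′ n → Fin n → Fin n
dual α x = α ⟨$⟩ˡ ζ x

⟨$⟩ʳ-dual : (α : Permutation′ n) → ∀ x → α ⟨$⟩ʳ dual α x ≡ ζ x
⟨$⟩ʳ-dual α x = Perm.inverseʳ α

dual-unique : (α : Permutation′ n) → ∀ x {y} → α ⟨$⟩ʳ y ≡ ζ x → dual α x ≡ y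
dual-unique α x eq = trans (cong (α ⟨$⟩ˡ_) (sym eq)) (Perm.inverseˡ α)

dual-injective : (α : Permutation′ n) → ∀ {x y} → dual α x ≡ dual α y → x ≡ y
dual-injective α {x} {y} eq = ζ-injective
  (trans (sym (⟨$⟩ʳ-dual α x)) (trans (cong (α ⟨$⟩ʳ_) eq) (⟨$⟩ʳ-dual α y)))

-- Every value `α(y)` is a successor `ζ x`; then `y` is `dual α x`, hence `dual β x`, so `β` also
-- sends `y` to `ζ x`.
dual-determines : (α β : Permutation′ n) → (∀ x → dual α x ≡ dual β x) → α ≈ β
dual-determines α β same y with ζ-surjective (α ⟨$⟩ʳ y)
... | x , eq = trans (sym eq) (trans (sym (⟨$⟩ʳ-dual β x))
  (cong (β ⟨$⟩ʳ_) (trans (sym (same x)) (dual-unique α x (sym eq)))))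

-- The label `i` is fixed by `dual α`. When `α` has to skip `i`, so has `ζ`, and both then land on
-- the common value of `α` and `ζ` at `i`; the mixed cases would put `i` in the range of
-- `punchIn i`.
dual-delete : ∀ (i : Fin (suc n)) (α : Permutation′ (suc n)) → α ⟨$⟩ʳ i ≡ ζ i →
              ∀ x → punchIn i (dual (delete i α) x) ≡ dual α (punchIn i x)
dual-delete i α αi≡ζi x =
  trans (cong (punchIn i) (dual-unique (delete i α) x δy≡ζx)) pin-y
  where
  i≢ : i ≢ dual α (punchIn i x)
  i≢ eq = punchInᵢ≢i i x
    (dual-injective α (trans (sym eq) (sym (dual-unique α i αi≡ζi))))

  y = punchOut i≢

  pin-y : punchIn i y ≡ dual α (punchIn i x)
  pin-y = punchIn-punchOut i≢

  αy≡ζx : α ⟨$⟩ʳ punchIn i y ≡ ζ (punchIn i x)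
  αy≡ζx = trans (cong (α ⟨$⟩ʳ_) pin-y) (⟨$⟩ʳ-dual α _)

  δy≡ζx : delete i α ⟨$⟩ʳ y ≡ ζ x
  δy≡ζx = Finₚ.punchIn-injective i _ _ (helper (delete-cases i α y) (ζ-punchIn i x))
    where
    helper : _ → _ → punchIn i (delete i α ⟨$⟩ʳ y) ≡ punchIn i (ζ x)
    helper (inj₁ p)       (inj₁ q)       = trans p (trans αy≡ζx q)
    helper (inj₁ p)       (inj₂ (q , _)) =
      contradiction (trans p (trans αy≡ζx q)) (punchInᵢ≢i i _)
    helper (inj₂ (p , _)) (inj₁ q)       =
      contradiction (trans (sym q) (trans (sym αy≡ζx) p)) (punchInᵢ≢i i _)
    helper (inj₂ (_ , p)) (inj₂ (_ , q)) = trans p (trans αi≡ζi q)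

-- The range of `embed` is closed under `dual α`, and `covers` limits what is lost to cycles of
-- `dual α` of length at most two. In this form the relation composes along a sequence of removals.
record Restriction (α : Permutation′ n) (β : Permutation′ m) : Set where
  field
    embed    : Fin m → Fin n
    mono     : StrictlyMonotone embed
    commutes : ∀ x → embed (dual β x) ≡ dual α (embed x)
    covers   : ∀ x → (∃[ y ] embed y ≡ x) ⊎ dual α (dual α x) ≡ x

restriction-refl : (α : Permutation′ n) → Restriction α α
restriction-refl α = record
  { embed = id ; mono = id ; commutes = λ _ → refl ; covers = λ x → inj₁ (x , refl) }

-- A label lost by the second restriction lies in the range of the first embedding, which carries
-- its short dual cycle back to `α`.
restriction-trans : {k : ℕ} {α : Permutation′ n} {β : Permutation′ m} {δ : Permutation′ k} →
                    Restriction α β → Restriction β δ → Restriction α δ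
restriction-trans {α = α} {β} {δ} r s = record
  { embed    = R.embed ∘ S.embed
  ; mono     = R.mono ∘ S.mono
  ; commutes = λ x → trans (cong R.embed (S.commutes x)) (R.commutes _)
  ; covers   = covers
  }
  where
  module R = Restriction r
  module S = Restriction s

  covers : ∀ x → (∃[ y ] R.embed (S.embed y) ≡ x) ⊎ dual α (dual α x) ≡ x
  covers x with R.covers x
  ... | inj₂ involutive = inj₂ involutive
  ... | inj₁ (y , refl) with S.covers y
  ...   | inj₁ (z , refl) = inj₁ (z , refl)
  ...   | inj₂ involutive = inj₂ (trans (cong (dual α) (sym (R.commutes y)))
    (trans (sym (R.commutes (dual β y))) (cong R.embed involutive)))

restriction-reflects-involutive : {α : Permutation′ n} {β : Permutation′ m} (r : Restriction α β) →
  let open Restriction r in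
  ∀ {x} → dual α (dual α (embed x)) ≡ embed x → dual β (dual β x) ≡ x
restriction-reflects-involutive {α = α} r involutive = strictlyMonotone⇒injective mono
  (trans (commutes _) (trans (cong (dual α) (commutes _)) involutive))
  where open Restriction r

-- A restriction without 2-cycles of the dual keeps exactly the labels that
-- lie outside the 2-cycles of the dual of α.
restriction-unique : {m′ : ℕ} {α : Permutation′ n} {β : Permutation′ m} {β′ : Permutation′ m′} →
  (∀ x → dual β (dual β x) ≢ x) → (∀ x → dual β′ (dual β′ x) ≢ x) →
  Restriction α β → Restriction α β′ → (m , β) ≋ (m′ , β′)
restriction-unique {α = α} {β} {β′} free free′ r r′ =
  conclude (sameRange⇒≡ R.mono R′.mono to from)
  where
  module R  = Restriction r
  module R′ = Restriction r′

  to : ∀ x → ∃[ y ] R′.embed y ≡ R.embed x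
  to x with R′.covers (R.embed x)
  ... | inj₁ found      = found
  -- A label kept by `r` but missed by `r′` lies in a short cycle of `dual α`, which `β` would
  -- inherit.
  ... | inj₂ involutive = contradiction (restriction-reflects-involutive r involutive) (free x)

  from : ∀ y → ∃[ x ] R.embed x ≡ R′.embed y
  from y with R.covers (R′.embed y)
  ... | inj₁ found      = found
  ... | inj₂ involutive = contradiction (restriction-reflects-involutive r′ involutive) (free′ y)

  conclude : Σ[ eq ∈ _ ≡ _ ] (∀ x → R.embed x ≡ R′.embed (subst Fin eq x)) → _
  conclude (refl , agree) = equal (dual-determines β β′ λ x →
    strictlyMonotone⇒injective R.mono
      (trans (R.commutes x) (trans (cong (dual α) (agree x))
        (trans (sym (R′.commutes x)) (sym (agree _))))))

-- Removing parallel edges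

-- The absence of dual fixed points rules out a dual cycle of length one, so the two labels are
-- distinct.
involutive⇒parallel : {α : Permutation′ n} → IsReduced α → ∀ {x} →
                      dual α (dual α x) ≡ x → Parallel α x (dual α x)
involutive⇒parallel {α = α} red {x} involutive = record
  { distinct = λ eq → IsReduced.no-dual-fixed-point red x
      (trans (cong (α ⟨$⟩ʳ_) eq) (⟨$⟩ʳ-dual α x))
  ; edge-i = trans (cong (α ⟨$⟩ʳ_) (sym involutive)) (⟨$⟩ʳ-dual α _)
  ; edge-j = ⟨$⟩ʳ-dual α x
  }

parallel⇒involutive : {α : Permutation′ n} {i j : Fin n} → Parallel α i j →
                      dual α (dual α i) ≡ i
parallel⇒involutive {α = α} {i} {j} p =
  trans (cong (dual α) (dual-unique α i edge-j)) (dual-unique α j edge-i)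
  where open Parallel p

parallel-sym : {α : Permutation′ n} {i j : Fin n} → Parallel α i j → Parallel α j i
parallel-sym p = record { distinct = distinct ∘ sym ; edge-i = edge-j ; edge-j = edge-i }
  where open Parallel p

module _ {α : Permutation′ (2+ n)} {i j : Fin (2+ n)} (p : Parallel α i j) where
  open Parallel p
  private
    j′ = punchOut distinct
    θ  = delete i (γ i j α)

    pin-j′ : punchIn i j′ ≡ j
    pin-j′ = punchIn-punchOut distinct

    -- This makes `dual-delete` applicable to the second deletion: `j` is fixed by the dual of
    -- `γ i j α`, and deleting `i` only restricts that dual.
    θj′≡ζj′ : θ ⟨$⟩ʳ j′ ≡ ζ j′
    θj′≡ζj′ = trans (cong (θ ⟨$⟩ʳ_) (sym fixes)) (⟨$⟩ʳ-dual θ j′)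
      where
      fixes : dual θ j′ ≡ j′
      fixes = Finₚ.punchIn-injective i _ _ (trans (dual-delete i (γ i j α) (γ-i p) j′)
        (dual-unique (γ i j α) (punchIn i j′) (trans (cong (γ i j α ⟨$⟩ʳ_) pin-j′)
          (trans (γ-j p) (cong ζ (sym pin-j′))))))

  kept : Fin n → Fin (2+ n)
  kept x = punchIn i (punchIn j′ x)

  kept≢i : ∀ x → kept x ≢ i
  kept≢i x = punchInᵢ≢i i _

  kept≢j : ∀ x → kept x ≢ j
  kept≢j x eq = punchInᵢ≢i j′ x (Finₚ.punchIn-injective i _ _ (trans eq (sym pin-j′)))

  dual-γ : ∀ {x} → x ≢ i → x ≢ j → dual (γ i j α) x ≡ dual α x
  dual-γ {x} x≢i x≢j = dual-unique (γ i j α) x (trans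
    (γ-other p
      (λ eq → x≢j (dual-injective α (trans eq (sym (dual-unique α j edge-i)))))
      (λ eq → x≢i (dual-injective α (trans eq (sym (dual-unique α i edge-j))))))
    (⟨$⟩ʳ-dual α x))

  -- Passing to `γ i j α` splits the 2-cycle of the dual into two fixed points and leaves the rest
  -- of the dual alone; each deletion then drops one of them.
  removePair-restriction : Restriction α (removePair α distinct)
  removePair-restriction = record
    { embed    = kept
    ; mono     = punchIn-strictlyMonotone i ∘ punchIn-strictlyMonotone j′
    ; commutes = λ x → trans (cong (punchIn i) (dual-delete j′ θ θj′≡ζj′ x))
        (trans (dual-delete i (γ i j α) (γ-i p) (punchIn j′ x)) (dual-γ (kept≢i x) (kept≢j x)))
    ; covers   = covers
    }
    where
    covers : ∀ x → (∃[ y ] kept y ≡ x) ⊎ dual α (dual α x) ≡ x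
    covers x with x ≟ i
    ... | yes refl = inj₂ (parallel⇒involutive p)
    ... | no x≢i with x ≟ j
    ...   | yes refl = inj₂ (parallel⇒involutive (parallel-sym p))
    ...   | no x≢j = inj₁ (punchOut j′≢ ,
      trans (cong (punchIn i) (punchIn-punchOut j′≢)) (punchIn-punchOut (x≢i ∘ sym)))
      where
      j′≢ : j′ ≢ punchOut (x≢i ∘ sym)
      j′≢ = x≢j ∘ sym ∘ Finₚ.punchOut-injective distinct (x≢i ∘ sym)

  module _ (red : IsReduced α) (cp : IsCyclicPartition α) where
    open IsReduced red
    open IsCyclicPartition cp

    -- If `j` comes before `ζ j` on the way round from `i`, it lies inside the edge from `i` to
    -- `ζ j`, which no label of the block of `i` may do. In the other order `i` would lie strictly
    -- between `j` and its successor.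
    parallel⇒≁ : ¬ (i ∼ j)
    parallel⇒≁ i∼j
      with Cyclic-total distinct (ζ-moves j ∘ sym) (λ eq → no-fixed-point i (trans edge-i (sym eq)))
    ... | inj₁ c = increasing i∼j (subst (Cyclic i j) (sym edge-i) c)
    ... | inj₂ c = ¬Cyclic-ζ j i (Cyclic-rotate (Cyclic-rotate c))

  -- The block of i lies in the cyclic interval from j + 1 to i and the block
  -- of j in the one from i + 1 to j.
  ¬Cyclic-across : IsReduced α → (cp : IsCyclicPartition α) → let open IsCyclicPartition cp in
    ∀ {x y} → x ≢ i → i ∼ x → j ∼ y → ¬ Cyclic x y (α ⟨$⟩ʳ x)
  ¬Cyclic-across red cp {x} {y} x≢i i∼x j∼y c = ¬i-y-j i-y-j
    where
    open IsReduced red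
    open IsCyclicPartition cp

    i≢ζj : i ≢ ζ j
    i≢ζj eq = no-fixed-point i (trans edge-i (sym eq))

    j≢ζi : j ≢ ζ i
    j≢ζi eq = no-fixed-point j (trans edge-j (sym eq))

    i≢y : i ≢ y
    i≢y refl = parallel⇒≁ red cp (∼-sym j∼y)

    -- The edge leaving `x` cannot jump over `i`, which belongs to the block of `x`.
    i-x-y : Cyclic i x y
    i-x-y with α ⟨$⟩ʳ x ≟ i
    ... | yes eq = Cyclic-rotate (Cyclic-rotate (subst (Cyclic x y) eq c))
    ... | no αx≢i with Cyclic-total x≢i (αx≢i ∘ sym) (no-fixed-point x ∘ sym)
    ...   | inj₁ xiα = contradiction xiα (increasing (∼-sym i∼x))
    ...   | inj₂ xαi = Cyclic-rotate (Cyclic-rotate (Cyclic-trans c xαi))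

    -- The edge from `i` to `ζ j` cannot jump over `x`, so `ζ j` is reached no later than `x`.
    i-ζj-y : Cyclic i (ζ j) y
    i-ζj-y with x ≟ ζ j
    ... | yes refl = i-x-y
    ... | no x≢ζj with Cyclic-total (x≢i ∘ sym) x≢ζj i≢ζj
    ...   | inj₁ ixζ = contradiction (subst (Cyclic i x) (sym edge-i) ixζ) (increasing i∼x)
    ...   | inj₂ iζx = Cyclic-trans iζx i-x-y

    ¬i-y-j : ¬ Cyclic i y j
    ¬i-y-j iyj = ¬Cyclic-ζ j i (Cyclic-rotate (Cyclic-rotate (Cyclic-trans i-ζj-y iyj)))

    -- Likewise the edge from `j` to `ζ i` cannot jump over `y`, which confines `y` to the interval
    -- from `i` to `j`.
    i-y-j : Cyclic i y j
    i-y-j with y ≟ j | y ≟ ζ i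
    ... | yes refl | _        = contradiction (Cyclic-rotate (Cyclic-rotate i-ζj-y)) (¬Cyclic-ζ j i)
    ... | no _     | yes refl = contradiction i-ζj-y (¬Cyclic-ζ i (ζ j))
    ... | no y≢j   | no y≢ζi with Cyclic-total i≢y y≢j distinct
    ...   | inj₁ iyj = iyj
    ...   | inj₂ ijy with Cyclic-total (y≢j ∘ sym) y≢ζi j≢ζi
    ...     | inj₁ jyζ = contradiction (subst (Cyclic j y) (sym edge-j) jyζ) (increasing j∼y)
    ...     | inj₂ jζy = contradiction
      (Cyclic-rotate (Cyclic-rotate (Cyclic-trans jζy (Cyclic-rotate ijy)))) (¬Cyclic-ζ i j)

-- The blocks of `i` and `j` are merged. The new edges at `i` and `j` lead to the cyclic successor
-- and enclose nothing; an old edge encloses no label of its own block, nor of the other merged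
-- block by `¬Cyclic-across`.
γ-cyclicPartition : {α : Permutation′ (2+ n)} {i j : Fin (2+ n)} → Parallel α i j →
                    IsReduced α → IsCyclicPartition α → IsCyclicPartition (γ i j α)
γ-cyclicPartition {n} {α} {i} {j} p red cp = record
  { _∼_           = _≈′_
  ; ∼-equivalence = record { refl = inj₁ ∼-refl ; sym = ≈′-sym ; trans = ≈′-trans }
  ; invariant     = invariant′
  ; increasing    = increasing′
  }
  where
  open IsCyclicPartition cp
  open Parallel p

  Merged : Fin (2+ n) → Set
  Merged x = i ∼ x ⊎ j ∼ x

  _≈′_ : Rel (Fin (2+ n)) 0ℓ
  x ≈′ y = x ∼ y ⊎ (Merged x × Merged y)

  merged-resp : ∀ {x y} → x ∼ y → Merged x → Merged y
  merged-resp x∼y (inj₁ i∼x) = inj₁ (∼-trans i∼x x∼y)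
  merged-resp x∼y (inj₂ j∼x) = inj₂ (∼-trans j∼x x∼y)

  ≈′-sym : ∀ {x y} → x ≈′ y → y ≈′ x
  ≈′-sym (inj₁ x∼y)     = inj₁ (∼-sym x∼y)
  ≈′-sym (inj₂ (a , b)) = inj₂ (b , a)

  ≈′-trans : ∀ {x y z} → x ≈′ y → y ≈′ z → x ≈′ z
  ≈′-trans (inj₁ x∼y)     (inj₁ y∼z)     = inj₁ (∼-trans x∼y y∼z)
  ≈′-trans (inj₁ x∼y)     (inj₂ (b , c)) = inj₂ (merged-resp (∼-sym x∼y) b , c)
  ≈′-trans (inj₂ (a , b)) (inj₁ y∼z)     = inj₂ (a , merged-resp y∼z b)
  ≈′-trans (inj₂ (a , _)) (inj₂ (_ , c)) = inj₂ (a , c)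

  invariant′ : ∀ x → x ≈′ (γ i j α ⟨$⟩ʳ x)
  invariant′ x with ≡-or-≢ x i | ≡-or-≢ x j
  ... | inj₁ refl | _ = inj₂ (inj₁ ∼-refl ,
    inj₂ (subst (j ∼_) (trans edge-j (sym (γ-i p))) (invariant j)))
  ... | inj₂ _ | inj₁ refl = inj₂ (inj₂ ∼-refl ,
    inj₁ (subst (i ∼_) (trans edge-i (sym (γ-j p))) (invariant i)))
  ... | inj₂ x≢i | inj₂ x≢j = inj₁ (subst (x ∼_) (sym (γ-other p x≢i x≢j)) (invariant x))

  increasing-other : ∀ {x y} → x ≢ i → x ≢ j → x ≈′ y → ¬ Cyclic x y (α ⟨$⟩ʳ x)
  increasing-other _   _   (inj₁ x∼y)                 = increasing x∼y
  increasing-other _   _   (inj₂ (inj₁ a , inj₁ b)) = increasing (∼-trans (∼-sym a) b)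
  increasing-other x≢i _   (inj₂ (inj₁ a , inj₂ b)) = ¬Cyclic-across p red cp x≢i a b
  increasing-other _   x≢j (inj₂ (inj₂ a , inj₁ b)) = ¬Cyclic-across (parallel-sym p) red cp x≢j a b
  increasing-other _   _   (inj₂ (inj₂ a , inj₂ b)) = increasing (∼-trans (∼-sym a) b)

  increasing′ : ∀ {x y} → x ≈′ y → ¬ Cyclic x y (γ i j α ⟨$⟩ʳ x)
  increasing′ {x} {y} x≈y c with ≡-or-≢ x i | ≡-or-≢ x j
  ... | inj₁ refl | _         = ¬Cyclic-ζ x y (subst (Cyclic x y) (γ-i p) c)
  ... | inj₂ _    | inj₁ refl = ¬Cyclic-ζ x y (subst (Cyclic x y) (γ-j p) c)
  ... | inj₂ x≢i  | inj₂ x≢j  =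
    increasing-other x≢i x≢j x≈y (subst (Cyclic x y) (γ-other p x≢i x≢j) c)

removePair-cyclicPartition : {α : Permutation′ (2+ n)} {i j : Fin (2+ n)} (p : Parallel α i j) →
  IsReduced α → IsCyclicPartition α → IsCyclicPartition (removePair α (Parallel.distinct p))
removePair-cyclicPartition {α = α} {i} {j} p red cp =
  delete-cyclicPartition (punchOut (Parallel.distinct p)) {delete i (γ i j α)}
    (delete-cyclicPartition i {γ i j α} (γ-cyclicPartition p red cp))

-- A dual fixed point would embed as one of `α`. A new fixed point can only come from a 2-cycle
-- through a deleted label, and in `γ i j α` such a cycle through a kept label would link the blocks
-- of `i` and `j`.
removePair-reduced : {α : Permutation′ (2+ n)} {i j : Fin (2+ n)} (p : Parallel α i j) →
  IsReduced α → IsCyclicPartition α → IsReduced (removePair α (Parallel.distinct p))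
removePair-reduced {n} {α} {i} {j} p red cp = record
  { no-fixed-point      = no-fixed
  ; no-dual-fixed-point = no-dual-fixed
  }
  where
  open IsReduced red
  open Parallel p
  open IsCyclicPartition cp
  open Restriction (removePair-restriction p)
  j′     = punchOut distinct
  pin-j′ = punchIn-punchOut distinct

  no-dual-fixed : ∀ x → removePair α distinct ⟨$⟩ʳ x ≢ ζ x
  no-dual-fixed x eq = no-dual-fixed-point (embed x)
    (trans (cong (α ⟨$⟩ʳ_) (trans (cong embed (sym (dual-unique (removePair α distinct) x eq)))
                               (commutes x)))
           (⟨$⟩ʳ-dual α (embed x)))

  γ′ = γ i j α ⟨$⟩ʳ_

  γ′≡α : ∀ x → γ′ (embed x) ≡ α ⟨$⟩ʳ embed x
  γ′≡α x = γ-other p (kept≢i p x) (kept≢j p x)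

  fixed-in-γ : ∀ x → γ′ (embed x) ≢ embed x
  fixed-in-γ x eq = no-fixed-point (embed x) (trans (sym (γ′≡α x)) eq)

  two-cycle-i : ∀ x → γ′ (embed x) ≡ i → γ′ i ≢ embed x
  two-cycle-i x γx≡i γi≡x = parallel⇒≁ p red cp (∼-sym (∼-trans
    (subst (j ∼_) (trans edge-j (trans (sym (γ-i p)) γi≡x)) (invariant j))
    (subst (embed x ∼_) (trans (sym (γ′≡α x)) γx≡i) (invariant (embed x)))))

  two-cycle-j : ∀ x → γ′ (embed x) ≡ j → γ′ j ≢ embed x
  two-cycle-j x γx≡j γj≡x = parallel⇒≁ p red cp (∼-trans
    (subst (i ∼_) (trans edge-i (trans (sym (γ-j p)) γj≡x)) (invariant i))
    (subst (embed x ∼_) (trans (sym (γ′≡α x)) γx≡j) (invariant (embed x))))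

  θ  = delete i (γ i j α)
  θ′ = θ ⟨$⟩ʳ_

  γ′i≢j : γ′ i ≢ j
  γ′i≢j eq = no-fixed-point j (trans edge-j (trans (sym (γ-i p)) eq))

  γ′j≢i : γ′ j ≢ i
  γ′j≢i eq = no-fixed-point i (trans edge-i (trans (sym (γ-j p)) eq))

  no-θ-fixed : ∀ x → θ′ (punchIn j′ x) ≢ punchIn j′ x
  no-θ-fixed x eq = helper (delete-fixed i (γ i j α) eq)
    where
    helper : ¬ (γ′ (embed x) ≡ embed x ⊎ (γ′ (embed x) ≡ i × γ′ i ≡ embed x))
    helper (inj₁ γx≡x)          = fixed-in-γ x γx≡x
    helper (inj₂ (γx≡i , γi≡x)) = two-cycle-i x γx≡i γi≡x

  -- Such a 2-cycle either was one of `γ i j α` already or arose by skipping `i`. The latter needs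
  -- an edge between `i` and `j`, hence a fixed point of `α`, or else two labels mapped to `i`.
  no-θ-two-cycle : ∀ x → θ′ (punchIn j′ x) ≡ j′ → θ′ j′ ≢ punchIn j′ x
  no-θ-two-cycle x to-j′ from-j′ =
    helper (delete-cases i (γ i j α) (punchIn j′ x)) (delete-cases i (γ i j α) j′)
    where
    to-j : punchIn i (θ′ (punchIn j′ x)) ≡ j
    to-j = trans (cong (punchIn i) to-j′) pin-j′

    from-j : punchIn i (θ′ j′) ≡ embed x
    from-j = cong (punchIn i) from-j′

    helper : punchIn i (θ′ (punchIn j′ x)) ≡ γ′ (embed x) ⊎
             (γ′ (embed x) ≡ i × punchIn i (θ′ (punchIn j′ x)) ≡ γ′ i) →
             ¬ (punchIn i (θ′ j′) ≡ γ′ (punchIn i j′) ⊎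
                (γ′ (punchIn i j′) ≡ i × punchIn i (θ′ j′) ≡ γ′ i))
    helper (inj₁ a)       (inj₁ b)       = two-cycle-j x (trans (sym a) to-j)
      (trans (cong γ′ (sym pin-j′)) (trans (sym b) from-j))
    helper (inj₂ (_ , a)) (inj₁ b)       = γ′i≢j (trans (sym a) to-j)
    helper (inj₁ a)       (inj₂ (b , _)) = γ′j≢i (trans (cong γ′ (sym pin-j′)) b)
    helper (inj₂ (a , _)) (inj₂ (b , _)) =
      kept≢j p x (trans (⟨$⟩ʳ-injective (γ i j α) (trans a (sym b))) pin-j′)

  no-fixed : ∀ x → removePair α distinct ⟨$⟩ʳ x ≢ x
  no-fixed x eq = helper (delete-fixed j′ θ eq)
    where
    helper : ¬ (θ′ (punchIn j′ x) ≡ punchIn j′ x ⊎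
                (θ′ (punchIn j′ x) ≡ j′ × θ′ j′ ≡ punchIn j′ x))
    helper (inj₁ fixed)            = no-θ-fixed x fixed
    helper (inj₂ (to-j′ , from-j′)) = no-θ-two-cycle x to-j′ from-j′

cyclicPartition⇒reducedPartition : {α : Permutation′ n} →
  IsCyclicPartition α → IsReduced α → IsReducedPartition α
cyclicPartition⇒reducedPartition {α = α} cp red =
  record { partition = cyclicPartition⇒partition α cp ; reduced = red }

removePair-reducedPartition : {α : Permutation′ (2+ n)} {i j : Fin (2+ n)} (p : Parallel α i j) →
  IsReducedPartition α → IsReducedPartition (removePair α (Parallel.distinct p))
removePair-reducedPartition {α = α} p rp = cyclicPartition⇒reducedPartition
  (removePair-cyclicPartition p reduced cp) (removePair-reduced p reduced cp)
  where
  open IsReducedPartition rp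
  cp = partition⇒cyclicPartition α partition

-- On two labels, every image of the first is either itself or its successor, so a removal never
-- leaves the empty permutation.
reduced⇒positive : {α : Permutation′ (2+ n)} → IsReduced α → 1 ≤ n
reduced⇒positive {zero} {α} red with α ⟨$⟩ʳ zero in eq
... | zero     = contradiction eq (IsReduced.no-fixed-point red zero)
... | suc zero = contradiction eq (IsReduced.no-dual-fixed-point red zero)
reduced⇒positive {suc n} _ = s≤s z≤n

-- Existence and uniqueness of the primitive partition

primitive⇒not-involutive : {α : Permutation′ n} → IsPrimitive α → ∀ x → dual α (dual α x) ≢ x
primitive⇒not-involutive prim x involutive = no-parallel
  (x , _ , involutive⇒parallel (IsReducedPartition.reduced reducedPartition) involutive)
  where open IsPrimitive prim

removals⇒restriction : {α : Permutation′ n} {β : Permutation′ m} →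
                       (n , α) ⟶* (m , β) → Restriction α β
removals⇒restriction ε                    = restriction-refl _
removals⇒restriction (removal rp p ◅ rest) =
  restriction-trans (removePair-restriction p) (removals⇒restriction rest)

ReducesToPrimitive : ∃ Permutation′ → Set
ReducesToPrimitive a =
  Σ[ m ∈ ℕ ] Σ[ β ∈ Permutation′ m ] (1 ≤ m × IsPrimitive β × a ⟶* (m , β))

extend : {a b : ∃ Permutation′} → a ⟶ b → ReducesToPrimitive b → ReducesToPrimitive a
extend step (m , β , 1≤m , prim , rest) = m , β , 1≤m , prim , step ◅ rest

reduces-to-primitive : ∀ n → 1 ≤ n → (α : Permutation′ n) → IsReducedPartition α →
  ReducesToPrimitive (n , α)
reduces-to-primitive zero () α rp
reduces-to-primitive (suc zero) _ α rp = contradiction fixed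
  (IsReduced.no-fixed-point (IsReducedPartition.reduced rp) zero)
  where
  fixed : α ⟨$⟩ʳ zero ≡ zero
  fixed with α ⟨$⟩ʳ zero
  ... | zero = refl
-- Searching for one label suffices, since its partner in a parallel pair can only be its image
-- under `dual α`.
reduces-to-primitive (2+ n) 1≤n α rp with Finₚ.any? (λ x → dual α (dual α x) ≟ x)
... | no free = _ , α , 1≤n , record
  { reducedPartition = rp
  ; no-parallel      = λ (i , _ , p) → free (i , parallel⇒involutive p)
  } , ε
... | yes (x , involutive) = extend (removal rp p) (reduces-to-primitive n
    (reduced⇒positive (IsReducedPartition.reduced rp))
    (removePair α (Parallel.distinct p)) (removePair-reducedPartition p rp))
  where
  p = involutive⇒parallel (IsReducedPartition.reduced rp) involutive

proposition5p7 : ∀ (n : ℕ) → 1 ≤ n → (α : Permutation′ n) → IsReducedPartition α →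
    Σ[ m ∈ ℕ ] Σ[ β ∈ Permutation′ m ]
    (1 ≤ m × IsPrimitive β × (n , α) ⟶* (m , β) ×
    (∀ (m′ : ℕ) (β′ : Permutation′ m′) → IsPrimitive β′ →
    (n , α) ⟶* (m′ , β′) → (m , β) ≋ (m′ , β′)))
proposition5p7 n 1≤n α rp with m , β , 1≤m , prim , steps ← reduces-to-primitive n 1≤n α rp =
  m , β , 1≤m , prim , steps , λ m′ β′ prim′ steps′ →
    restriction-unique (primitive⇒not-involutive prim) (primitive⇒not-involutive prim′)
      (removals⇒restriction steps) (removals⇒restriction steps′)
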